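{- For every positive integer $d$, $box(TC(H_d)) \leq cub(TC(H_d)) \leq d-1$.
   Context: All graphs are finite, simple and undirected. Boxicity and cubicity: a $k$-box (resp. $k$-cube) is a Cartesian product of $k$ closed intervals (resp. closed unit-length intervals) of $\mathbb{R}$. A $k$-box (resp. $k$-cube) representation of a graph $\Gamma$ is a function $f$ assigning to each vertex a $k$-box (resp. $k$-cube) such that two distinct vertices $u,v$ are adjacent if and only if $f(u)\cap f(v)\neq\emptyset$. The boxicity $box(\Gamma)$ (resp. cubicity $cub(\Gamma)$) is the smallest non-negative integer $k$ for which $\Gamma$ has a $k$-box (resp. $k$-cube) representation; complete graphs have boxicity and cubicity $0$. $TC(H_d)$, the transitive closure of the $d$-dimensional hypercube, is the graph with vertex set $\{0,1\}^d$ in which two distinct vertices $x,y$ are adjacent if and only if either $x_i\leq y_i$ for all $i$, or $x_i\geq y_i$ for all $i$ (equivalently, the comparability graph of the power set of $\{1,\dots,d\}$ ordered by inclusion). -}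

module Defs where

open import Data.Bool using (Bool) renaming (_≤_ to _≤ᵇ_; _≤?_ to _≤ᵇ?_; _≟_ to _≟ᵇ_)
open import Data.Fin using (Fin; zero; suc)
open import Data.Fin.Properties using (2↔Bool; *↔×; all?) renaming (_≟_ to _≟ᶠ_)
open import Data.Nat as ℕ using (ℕ)
import Data.Nat.Properties as ℕ
open import Data.Nat.Induction using (<-rec)
open import Data.Product using (Σ; ∃; ∃-syntax; _×_; _,_; proj₁; proj₂)
open import Data.Product.Function.NonDependent.Propositional using (_×-↔_)
open import Data.Rational as ℚ using (ℚ; 0ℚ; 1ℚ)
import Data.Rational.Properties as ℚ
open import Data.Sum using (_⊎_; inj₁; inj₂; [_,_]; swap)
open import Data.Vec using (Vec; []; _∷_; lookup; uncons)
open import Data.Vec.Properties using (≡-dec)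
open import Function using (_∘_)
open import Function.Bundles using (_⇔_; _↔_; mk⇔; mk↔ₛ′; module Equivalence; module Inverse)
open import Function.Construct.Composition using (_↔-∘_)
open import Function.Construct.Symmetry using (↔-sym)
open import Relation.Binary.Definitions using (Symmetric; Irreflexive; Decidable)
open import Relation.Binary.PropositionalEquality using (_≡_; _≢_; refl; sym; trans; cong; subst)
open import Relation.Nullary using (¬_; Dec; yes; no; contradiction; ¬?)
open import Relation.Nullary.Decidable using (_×-dec_; _⊎-dec_; from-yes; from-no)

------------------------------------------------------------------------
-- Real numbers, as two-sided Dedekind cuts of ℚ

record ℝ : Set₁ where
  field
    L U         : ℚ → Set
    L-inhabited : ∃[ q ] L q
    U-inhabited : ∃[ q ] U q
    L-rounded   : ∀ q → L q ⇔ (∃[ r ] (q ℚ.< r × L r))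
    U-rounded   : ∀ r → U r ⇔ (∃[ q ] (q ℚ.< r × U q))
    disjoint    : ∀ q → ¬ (L q × U q)
    located     : ∀ q r → q ℚ.< r → L q ⊎ U r

open ℝ

infix 4 _≤ʳ_ _≃ʳ_
infixl 6 _+ʳ_

_≤ʳ_ : ℝ → ℝ → Set
x ≤ʳ y = ∀ q → L x q → L y q

_≃ʳ_ : ℝ → ℝ → Set
x ≃ʳ y = x ≤ʳ y × y ≤ʳ x

[p-s]+s≡p : ∀ p s → (p ℚ.- s) ℚ.+ s ≡ p
[p-s]+s≡p p s = trans (ℚ.+-assoc p (ℚ.- s) s)
  (trans (cong (p ℚ.+_) (ℚ.+-inverseˡ s)) (ℚ.+-identityʳ p))

[p+s]-s≡p : ∀ p s → (p ℚ.+ s) ℚ.- s ≡ p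
[p+s]-s≡p p s = trans (ℚ.+-assoc p s (ℚ.- s))
  (trans (cong (p ℚ.+_) (ℚ.+-inverseʳ s)) (ℚ.+-identityʳ p))

p-1<p : ∀ p → p ℚ.- 1ℚ ℚ.< p
p-1<p p = subst (p ℚ.- 1ℚ ℚ.<_) (ℚ.+-identityʳ p)
  (ℚ.+-monoʳ-< p (from-yes (ℚ.- 1ℚ ℚ.<? 0ℚ)))

p<p+1 : ∀ p → p ℚ.< p ℚ.+ 1ℚ
p<p+1 p = subst (ℚ._< p ℚ.+ 1ℚ) (ℚ.+-identityʳ p)
  (ℚ.+-monoʳ-< p (from-yes (0ℚ ℚ.<? 1ℚ)))

<-locate : ∀ a {q r} → q ℚ.< r → q ℚ.< a ⊎ a ℚ.< r
<-locate a {q} q<r with q ℚ.<? a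
... | yes q<a = inj₁ q<a
... | no  q≮a = inj₂ (ℚ.≤-<-trans (ℚ.≮⇒≥ q≮a) q<r)

fromℚ : ℚ → ℝ
fromℚ a = record
  { L           = ℚ._< a
  ; U           = a ℚ.<_
  ; L-inhabited = a ℚ.- 1ℚ , p-1<p a
  ; U-inhabited = a ℚ.+ 1ℚ , p<p+1 a
  ; L-rounded   = λ _ → mk⇔ ℚ.<-dense (λ (_ , q<r , r<a) → ℚ.<-trans q<r r<a)
  ; U-rounded   = λ _ → mk⇔ (λ a<r → let m , a<m , m<r = ℚ.<-dense a<r in m , m<r , a<m)
                            (λ (_ , q<r , a<q) → ℚ.<-trans a<q q<r)
  ; disjoint    = λ _ (q<a , a<q) → ℚ.<-asym q<a a<q
  ; located     = λ _ _ → <-locate a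
  }

-- Addition of a rational; it is only needed to say that an interval has length 1.
_+ʳ_ : ℝ → ℚ → ℝ
x +ʳ s = record
  { L           = λ q → L x (q ℚ.- s)
  ; U           = λ q → U x (q ℚ.- s)
  ; L-inhabited = let q , Lq = L-inhabited x in
                  q ℚ.+ s , subst (L x) (sym ([p+s]-s≡p q s)) Lq
  ; U-inhabited = let q , Uq = U-inhabited x in
                  q ℚ.+ s , subst (U x) (sym ([p+s]-s≡p q s)) Uq
  ; L-rounded   = λ q → mk⇔
      (λ Lq → let r , q-s<r , Lr = to (L-rounded x (q ℚ.- s)) Lq in
        r ℚ.+ s
        , subst (ℚ._< r ℚ.+ s) ([p-s]+s≡p q s) (ℚ.+-monoˡ-< s q-s<r)
        , subst (L x) (sym ([p+s]-s≡p r s)) Lr)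
      (λ (r , q<r , Lr) →
        from (L-rounded x (q ℚ.- s)) (r ℚ.- s , ℚ.+-monoˡ-< (ℚ.- s) q<r , Lr))
  ; U-rounded   = λ r → mk⇔
      (λ Ur → let q , q<r-s , Uq = to (U-rounded x (r ℚ.- s)) Ur in
        q ℚ.+ s
        , subst (q ℚ.+ s ℚ.<_) ([p-s]+s≡p r s) (ℚ.+-monoˡ-< s q<r-s)
        , subst (U x) (sym ([p+s]-s≡p q s)) Uq)
      (λ (q , q<r , Uq) →
        from (U-rounded x (r ℚ.- s)) (q ℚ.- s , ℚ.+-monoˡ-< (ℚ.- s) q<r , Uq))
  ; disjoint    = λ q → disjoint x (q ℚ.- s)
  ; located     = λ q r q<r → located x _ _ (ℚ.+-monoˡ-< (ℚ.- s) q<r)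
  }
  where open Equivalence

------------------------------------------------------------------------
-- Boxes and cubes

record Interval : Set₁ where
  field
    lo hi : ℝ
    lo≤hi : lo ≤ʳ hi

open Interval

infix 4 _∈ᴵ_ _∈ᴮ_

_∈ᴵ_ : ℝ → Interval → Set
p ∈ᴵ I = lo I ≤ʳ p × p ≤ʳ hi I

IsUnit : Interval → Set
IsUnit I = hi I ≃ʳ lo I +ʳ 1ℚ

Box : ℕ → Set₁
Box k = Fin k → Interval

_∈ᴮ_ : ∀ {k} → (Fin k → ℝ) → Box k → Set
p ∈ᴮ B = ∀ i → p i ∈ᴵ B i

Intersects : ∀ {k} → Box k → Box k → Set₁
Intersects B C = ∃[ p ] (p ∈ᴮ B × p ∈ᴮ C)

IsCube : ∀ {k} → Box k → Set
IsCube B = ∀ i → IsUnit (B i)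

------------------------------------------------------------------------
-- Finite simple graphs

record Graph : Set₁ where
  field
    Vertex : Set
    order  : ℕ
    finite : Vertex ↔ Fin order
    Adj    : Vertex → Vertex → Set
    adj?   : Decidable Adj
    symm   : Symmetric Adj
    irrefl : Irreflexive _≡_ Adj

open Graph

------------------------------------------------------------------------
-- Boxicity and cubicity

Represents : ∀ {k} (Γ : Graph) → (Vertex Γ → Box k) → Set₁
Represents Γ f = ∀ u v → u ≢ v → Adj Γ u v ⇔ Intersects (f u) (f v)

HasBoxRep : Graph → ℕ → Set₁
HasBoxRep Γ k = Σ (Vertex Γ → Box k) λ f → Represents Γ f

HasCubeRep : Graph → ℕ → Set₁
HasCubeRep Γ k = Σ (Vertex Γ → Box k) λ f → (∀ v → IsCube (f v)) × Represents Γ f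

IsSmallest : ∀ {ℓ} → (ℕ → Set ℓ) → ℕ → Set ℓ
IsSmallest P n = P n × (∀ m → P m → n ℕ.≤ m)

-- Boxicity and cubicity are relations between a graph and a number, because
-- selecting the smallest element of a set of naturals is not constructive.
-- The values are unique (`smallest-unique`) and exist for every graph up to
-- double negation, hence classically (`boxicity-exists`, `cubicity-exists`).

IsBoxicity : Graph → ℕ → Set₁
IsBoxicity Γ = IsSmallest (HasBoxRep Γ)

IsCubicity : Graph → ℕ → Set₁
IsCubicity Γ = IsSmallest (HasCubeRep Γ)

smallest-unique : ∀ {ℓ} {P : ℕ → Set ℓ} {m n} → IsSmallest P m → IsSmallest P n → m ≡ n
smallest-unique (Pm , m≤) (Pn , n≤) = ℕ.≤-antisym (m≤ _ Pn) (n≤ _ Pm)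

smallest-exists : ∀ {ℓ} {P : ℕ → Set ℓ} → ∃ P → ¬ ¬ ∃ (IsSmallest P)
smallest-exists {P = P} (n , Pn) none =
  <-rec (λ m → ¬ P m)
    (λ m below Pm → none (m , Pm , λ l Pl → ℕ.≮⇒≥ (λ l<m → below l<m Pl)))
    n Pn

-- Every graph has a cube representation with one coordinate per vertex w, in
-- which w starts at 0, its neighbours at 1 and all other vertices at 2.

2ℚ : ℚ
2ℚ = 1ℚ ℚ.+ 1ℚ

+1-upper : ∀ {r a} → r ℚ.≤ a ℚ.+ 1ℚ → fromℚ r ≤ʳ fromℚ a +ʳ 1ℚ
+1-upper {r} {a} r≤a+1 q q<r = subst (q ℚ.- 1ℚ ℚ.<_) ([p+s]-s≡p a 1ℚ)
  (ℚ.+-monoˡ-< (ℚ.- 1ℚ) (ℚ.<-≤-trans q<r r≤a+1))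

unit : ℚ → Interval
unit a = record
  { lo = fromℚ a ; hi = fromℚ a +ʳ 1ℚ ; lo≤hi = +1-upper (ℚ.<⇒≤ (p<p+1 a)) }

∈-unit : ∀ {r a} → a ℚ.≤ r → r ℚ.≤ a ℚ.+ 1ℚ → fromℚ r ∈ᴵ unit a
∈-unit a≤r r≤a+1 = (λ q q<a → ℚ.<-≤-trans q<a a≤r) , +1-upper r≤a+1

0-2-disjoint : ∀ {p} → p ∈ᴵ unit 0ℚ → ¬ (p ∈ᴵ unit 2ℚ)
0-2-disjoint (_ , p≤1) (2≤p , _) =
  from-no (1ℚ ℚ.- 1ℚ ℚ.<? 0ℚ) (p≤1 1ℚ (2≤p 1ℚ (from-yes (1ℚ ℚ.<? 2ℚ))))

module Star (Γ : Graph) where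
  open Inverse (finite Γ) using (to; from; strictlyInverseʳ)

  _≟_ : Decidable {A = Vertex Γ} _≡_
  u ≟ v with to u ≟ᶠ to v
  ... | yes eq = yes (trans (sym (strictlyInverseʳ u))
                       (trans (cong from eq) (strictlyInverseʳ v)))
  ... | no neq = no (neq ∘ cong to)

  start : Vertex Γ → Vertex Γ → ℚ
  start w u with u ≟ w
  ... | yes _ = 0ℚ
  ... | no _ with adj? Γ u w
  ...   | yes _ = 1ℚ
  ...   | no _  = 2ℚ

  start-self : ∀ w → start w w ≡ 0ℚ
  start-self w with w ≟ w
  ... | yes _   = refl
  ... | no w≢w  = contradiction refl w≢w

  start-far : ∀ {w u} → u ≢ w → ¬ Adj Γ u w → start w u ≡ 2ℚ
  start-far {w} {u} u≢w ¬uw with u ≟ w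
  ... | yes u≡w = contradiction u≡w u≢w
  ... | no _ with adj? Γ u w
  ...   | yes uw = contradiction uw ¬uw
  ...   | no _   = refl

  1∈ : ∀ {w u} → u ≡ w ⊎ Adj Γ u w → fromℚ 1ℚ ∈ᴵ unit (start w u)
  1∈ {w} {u} near with u ≟ w
  ... | yes _ = ∈-unit (from-yes (0ℚ ℚ.≤? 1ℚ)) (from-yes (1ℚ ℚ.≤? 0ℚ ℚ.+ 1ℚ))
  ... | no u≢w with adj? Γ u w
  ...   | yes _  = ∈-unit (from-yes (1ℚ ℚ.≤? 1ℚ)) (from-yes (1ℚ ℚ.≤? 2ℚ))
  ...   | no ¬uw = contradiction near [ u≢w , ¬uw ]

  2∈ : ∀ {w u} → u ≢ w → fromℚ 2ℚ ∈ᴵ unit (start w u)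
  2∈ {w} {u} u≢w with u ≟ w
  ... | yes u≡w = contradiction u≡w u≢w
  ... | no _ with adj? Γ u w
  ...   | yes _ = ∈-unit (from-yes (1ℚ ℚ.≤? 2ℚ)) (from-yes (2ℚ ℚ.≤? 1ℚ ℚ.+ 1ℚ))
  ...   | no _  = ∈-unit (from-yes (2ℚ ℚ.≤? 2ℚ)) (from-yes (2ℚ ℚ.≤? 2ℚ ℚ.+ 1ℚ))

  meet : ∀ w {u v} → Adj Γ u v →
         ∃[ p ] (p ∈ᴵ unit (start w u) × p ∈ᴵ unit (start w v))
  meet w {u} {v} uv = go (u ≟ w) (v ≟ w)
    where
    go : Dec (u ≡ w) → Dec (v ≡ w) →
         ∃[ p ] (p ∈ᴵ unit (start w u) × p ∈ᴵ unit (start w v))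
    go (yes refl) _          = fromℚ 1ℚ , 1∈ (inj₁ refl) , 1∈ (inj₂ (symm Γ uv))
    go (no _)     (yes refl) = fromℚ 1ℚ , 1∈ (inj₂ uv) , 1∈ (inj₁ refl)
    go (no u≢w)   (no v≢w)   = fromℚ 2ℚ , 2∈ u≢w , 2∈ v≢w

  cubes : Vertex Γ → Box (order Γ)
  cubes u i = unit (start (from i) u)

  represents : Represents Γ cubes
  represents u v u≢v = mk⇔
    (λ uv → (λ i → proj₁ (meet (from i) uv))
          , (λ i → proj₁ (proj₂ (meet (from i) uv)))
          , (λ i → proj₂ (proj₂ (meet (from i) uv))))
    back
    where
    back : Intersects (cubes u) (cubes v) → Adj Γ u v
    back (p , p∈u , p∈v) with adj? Γ u v
    ... | yes uv = uv
    ... | no ¬uv = contradiction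
      (subst (λ a → p i ∈ᴵ unit a) v-far (p∈v i))
      (0-2-disjoint {p i} (subst (λ a → p i ∈ᴵ unit a) u-self (p∈u i)))
      where
      i = to u
      u-self : start (from i) u ≡ 0ℚ
      u-self = trans (cong (λ w → start w u) (strictlyInverseʳ u)) (start-self u)
      v-far : start (from i) v ≡ 2ℚ
      v-far = trans (cong (λ w → start w v) (strictlyInverseʳ u))
                (start-far (u≢v ∘ sym) (¬uv ∘ symm Γ))

cubeRep : ∀ Γ → HasCubeRep Γ (order Γ)
cubeRep Γ = cubes , (λ _ _ → (λ _ l → l) , (λ _ l → l)) , represents
  where open Star Γ

cubicity-exists : ∀ Γ → ¬ ¬ ∃ (IsCubicity Γ)
cubicity-exists Γ = smallest-exists (order Γ , cubeRep Γ)

boxicity-exists : ∀ Γ → ¬ ¬ ∃ (IsBoxicity Γ)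
boxicity-exists Γ = let f , _ , rep = cubeRep Γ in smallest-exists (order Γ , f , rep)

------------------------------------------------------------------------
-- The transitive closure of the hypercube

infix 4 _≤ᵛ_

_≤ᵛ_ : ∀ {d} → Vec Bool d → Vec Bool d → Set
x ≤ᵛ y = ∀ i → lookup x i ≤ᵇ lookup y i

_≤ᵛ?_ : ∀ {d} → Decidable (_≤ᵛ_ {d})
x ≤ᵛ? y = all? λ i → lookup x i ≤ᵇ? lookup y i

Vec-Bool↔Fin : ∀ d → Vec Bool d ↔ Fin (2 ℕ.^ d)
Vec-Bool↔Fin ℕ.zero = mk↔ₛ′ (λ _ → zero) (λ _ → []) (λ { zero → refl ; (suc ()) }) (λ { [] → refl })
Vec-Bool↔Fin (ℕ.suc d) =
  ↔-sym *↔× ↔-∘ ((↔-sym 2↔Bool ×-↔ Vec-Bool↔Fin d) ↔-∘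
    mk↔ₛ′ uncons (λ (b , x) → b ∷ x) (λ _ → refl) (λ { (_ ∷ _) → refl }))

TC-H : ℕ → Graph
TC-H d = record
  { Vertex = Vec Bool d
  ; order  = 2 ℕ.^ d
  ; finite = Vec-Bool↔Fin d
  ; Adj    = λ x y → x ≢ y × (x ≤ᵛ y ⊎ y ≤ᵛ x)
  ; adj?   = λ x y → ¬? (≡-dec _≟ᵇ_ x y) ×-dec (x ≤ᵛ? y ⊎-dec y ≤ᵛ? x)
  ; symm   = λ (x≢y , cmp) → x≢y ∘ sym , swap cmp
  ; irrefl = λ x≡y (x≢y , _) → x≢y x≡y
  }

{-# OPTIONS --safe #-}
-- For d = suc n, read a vertex x as a binary fraction v x ∈ [0, 1), head bit most
-- significant, and for each of the n positions i other than the head let the i-th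
-- interval of x start at v x if x contains i and at 1 + v x otherwise.  Then x and y
-- are separated at i iff, up to exchanging them, i ∈ x, i ∉ y and v x < v y.  This
-- implies x ≰ y, and also y ≰ x because v is monotone.  Conversely, if x and y are
-- incomparable and v x < v y, then some i lies in x but not in y, and i is not the
-- head because otherwise v y < v x.
module Submission where

open import Defs
open import Data.Bool using (Bool; true; false; not; if_then_else_; b≤b; f≤t)
  renaming (_≤_ to _≤ᵇ_; _≤?_ to _≤ᵇ?_)
open import Data.Fin using (zero; suc)
open import Data.Fin.Properties using (¬∀⟶∃¬)
open import Data.Nat using (ℕ; _≤_; _∸_)
open import Data.Product using (∃-syntax; _×_; _,_; proj₁; proj₂)
open import Data.Rational as ℚ using (ℚ; 0ℚ; 1ℚ; ½)
import Data.Rational.Properties as ℚ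
open import Data.Sum as Sum using (_⊎_; inj₁; inj₂)
open import Data.Vec using (Vec; []; _∷_; lookup)
open import Function using (_∘_)
open import Function.Bundles using (mk⇔)
open import Relation.Binary.PropositionalEquality using (_≡_; _≢_; refl; cong)
open import Relation.Nullary using (¬_; yes; no; contradiction)

-- The larger left endpoint is a common point; each hypothesis keeps it within the right end of one
-- interval.
units-meet : ∀ {a b} → a ℚ.≤ b ℚ.+ 1ℚ → b ℚ.≤ a ℚ.+ 1ℚ →
             ∃[ p ] (p ∈ᴵ unit a × p ∈ᴵ unit b)
units-meet {a} {b} a≤b+1 b≤a+1 =
  fromℚ (a ℚ.⊔ b)
  , ∈-unit (ℚ.p≤p⊔q a b) (ℚ.⊔-lub (ℚ.<⇒≤ (p<p+1 a)) b≤a+1)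
  , ∈-unit (ℚ.p≤q⊔p a b) (ℚ.⊔-lub a≤b+1 (ℚ.<⇒≤ (p<p+1 b)))

-- If a + 1 < b, the rational a + 1 lies in the lower cut of `p`, hence in that of the right end a +
-- 1 itself, which is absurd.
units-meet⁻ : ∀ {a b} p → p ∈ᴵ unit a → p ∈ᴵ unit b → b ℚ.≤ a ℚ.+ 1ℚ
units-meet⁻ {a} _ (_ , p≤a+1) (b≤p , _) = ℚ.≮⇒≥ λ a+1<b →
  ℚ.<-irrefl ([p+s]-s≡p a 1ℚ) (p≤a+1 _ (b≤p _ a+1<b))

bit : Bool → ℚ
bit b = if b then 1ℚ else 0ℚ

bit≤1 : ∀ b → bit b ℚ.≤ 1ℚ
bit≤1 true  = ℚ.≤-refl
bit≤1 false = ℚ.nonNegative⁻¹ 1ℚ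

0≤bit : ∀ b → 0ℚ ℚ.≤ bit b
0≤bit true  = ℚ.nonNegative⁻¹ 1ℚ
0≤bit false = ℚ.≤-refl

bit-mono-≤ : ∀ {b c} → b ≤ᵇ c → bit b ℚ.≤ bit c
bit-mono-≤ b≤b = ℚ.≤-refl
bit-mono-≤ f≤t = ℚ.nonNegative⁻¹ 1ℚ

value : ∀ {d} → Vec Bool d → ℚ
value []      = 0ℚ
value (b ∷ x) = ½ ℚ.* (bit b ℚ.+ value x)

½*-mono-≤ : ∀ {p q} → p ℚ.≤ q → ½ ℚ.* p ℚ.≤ ½ ℚ.* q
½*-mono-≤ = ℚ.*-monoˡ-≤-nonNeg ½

½*-mono-< : ∀ {p q} → p ℚ.< q → ½ ℚ.* p ℚ.< ½ ℚ.* q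
½*-mono-< = ℚ.*-monoʳ-<-pos ½

0≤value : ∀ {d} (x : Vec Bool d) → 0ℚ ℚ.≤ value x
0≤value []      = ℚ.≤-refl
0≤value (b ∷ x) = ½*-mono-≤ (ℚ.+-mono-≤ (0≤bit b) (0≤value x))

value<1 : ∀ {d} (x : Vec Bool d) → value x ℚ.< 1ℚ
value<1 []      = ℚ.positive⁻¹ 1ℚ
-- The upper bound obtained, ½ (1 + 1), evaluates to `1ℚ`.
value<1 (b ∷ x) = ½*-mono-< (ℚ.+-mono-≤-< (bit≤1 b) (value<1 x))

value-mono-≤ : ∀ {d} (x y : Vec Bool d) → x ≤ᵛ y → value x ℚ.≤ value y
value-mono-≤ []      []      _   = ℚ.≤-refl
value-mono-≤ (b ∷ x) (c ∷ y) x≤y =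
  ½*-mono-≤ (ℚ.+-mono-≤ (bit-mono-≤ (x≤y zero)) (value-mono-≤ x y (x≤y ∘ suc)))

-- The head bit contributes ½, all later bits together strictly less than ½.
value-head-< : ∀ {d} (x y : Vec Bool d) → value (false ∷ x) ℚ.< value (true ∷ y)
value-head-< x y = ½*-mono-< (begin-strict
  0ℚ ℚ.+ value x ≡⟨ ℚ.+-identityˡ (value x) ⟩
  value x        <⟨ value<1 x ⟩
  1ℚ ℚ.+ 0ℚ      ≤⟨ ℚ.+-monoʳ-≤ 1ℚ (0≤value y) ⟩
  1ℚ ℚ.+ value y ∎)
  where open ℚ.≤-Reasoning

value-tail-< : ∀ {d} b (x y : Vec Bool d) → value x ℚ.< value y →
               value (b ∷ x) ℚ.< value (b ∷ y)
value-tail-< b _ _ x<y = ½*-mono-< (ℚ.+-monoʳ-< (bit b) x<y)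

-- The first position at which the vectors differ decides.
value-connex : ∀ {d} {x y : Vec Bool d} → x ≢ y → value x ℚ.< value y ⊎ value y ℚ.< value x
value-connex {x = []}        {[]}        x≢y = contradiction refl x≢y
value-connex {x = false ∷ x} {true ∷ y}  _   = inj₁ (value-head-< x y)
value-connex {x = true ∷ x}  {false ∷ y} _   = inj₂ (value-head-< y x)
value-connex {x = true ∷ x}  {true ∷ y}  x≢y =
  Sum.map (value-tail-< true x y) (value-tail-< true y x) (value-connex (x≢y ∘ cong (true ∷_)))
value-connex {x = false ∷ x} {false ∷ y} x≢y =
  Sum.map (value-tail-< false x y) (value-tail-< false y x) (value-connex (x≢y ∘ cong (false ∷_)))

witness-≰ : ∀ {d} (x y : Vec Bool d) → ¬ (x ≤ᵛ y) →
            ∃[ i ] (lookup x i ≡ true × lookup y i ≡ false)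
witness-≰ x y x≰y =
  let i , xi≰yi = ¬∀⟶∃¬ _ _ (λ i → lookup x i ≤ᵇ? lookup y i) x≰y in i , bits xi≰yi
  where
  bits : ∀ {b c} → ¬ (b ≤ᵇ c) → b ≡ true × c ≡ false
  bits {true}  {false} _   = refl , refl
  bits {true}  {true}  b≰c = contradiction b≤b b≰c
  bits {false} {true}  b≰c = contradiction f≤t b≰c
  bits {false} {false} b≰c = contradiction b≤b b≰c

offset : Bool → ℚ
offset b = bit (not b)

cubes : ∀ {n} → Vec Bool (ℕ.suc n) → Box n
cubes x i = unit (offset (lookup x (suc i)) ℚ.+ value x)

-- Only for `b ≡ false` and `c ≡ true` is the left offset the larger one; its excess of 1 uses up
-- the added 1 and leaves u ≤ v. In all other cases u ≤ 1 ≤ v + 1 suffices.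
offset+-≤ : ∀ b c {u v} → (b ≡ false → c ≡ true → u ℚ.≤ v) →
            u ℚ.≤ 1ℚ → 0ℚ ℚ.≤ v →
            offset b ℚ.+ u ℚ.≤ offset c ℚ.+ v ℚ.+ 1ℚ
offset+-≤ b c {u} {v} u≤v u≤1 0≤v = begin
  offset b ℚ.+ u          ≤⟨ bound b c u≤v ⟩
  offset c ℚ.+ (v ℚ.+ 1ℚ) ≡⟨ ℚ.+-assoc (offset c) v 1ℚ ⟨
  offset c ℚ.+ v ℚ.+ 1ℚ   ∎
  where
  open ℚ.≤-Reasoning
  u≤v+1 : u ℚ.≤ v ℚ.+ 1ℚ
  u≤v+1 = begin
    u           ≤⟨ u≤1 ⟩
    0ℚ ℚ.+ 1ℚ   ≤⟨ ℚ.+-monoˡ-≤ 1ℚ 0≤v ⟩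
    v ℚ.+ 1ℚ    ∎
  bound : ∀ b c → (b ≡ false → c ≡ true → u ℚ.≤ v) →
          offset b ℚ.+ u ℚ.≤ offset c ℚ.+ (v ℚ.+ 1ℚ)
  bound true  c     _ = ℚ.+-mono-≤ (0≤bit (not c)) u≤v+1
  bound false false _ = ℚ.+-monoʳ-≤ 1ℚ u≤v+1
  bound false true  u≤v = begin
    1ℚ ℚ.+ u          ≤⟨ ℚ.+-monoʳ-≤ 1ℚ (u≤v refl refl) ⟩
    1ℚ ℚ.+ v          ≡⟨ ℚ.+-comm 1ℚ v ⟩
    v ℚ.+ 1ℚ          ≡⟨ ℚ.+-identityˡ (v ℚ.+ 1ℚ) ⟨
    0ℚ ℚ.+ (v ℚ.+ 1ℚ) ∎

≤ᵛ⇒cubes-meet : ∀ {n} (x y : Vec Bool (ℕ.suc n)) → x ≤ᵛ y → Intersects (cubes x) (cubes y)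
≤ᵛ⇒cubes-meet x y x≤y =
  (proj₁ ∘ meet) , (proj₁ ∘ proj₂ ∘ meet) , (proj₂ ∘ proj₂ ∘ meet)
  where
  not-below : ∀ {b c} → b ≤ᵇ c → c ≡ false → b ≢ true
  not-below b≤b refl ()
  meet : ∀ i → ∃[ p ] (p ∈ᴵ cubes x i × p ∈ᴵ cubes y i)
  -- The critical case of the first bound, position in y but not in x, is settled by monotonicity of
  -- `value`; that of the second, position in x but not in y, is excluded by x ≤ y.
  meet i = units-meet
    (offset+-≤ (lookup x (suc i)) (lookup y (suc i))
      (λ _ _ → value-mono-≤ x y x≤y) (ℚ.<⇒≤ (value<1 x)) (0≤value y))
    (offset+-≤ (lookup y (suc i)) (lookup x (suc i))
      (λ yi≡f xi≡t → contradiction xi≡t (not-below (x≤y (suc i)) yi≡f))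
      (ℚ.<⇒≤ (value<1 y)) (0≤value x))

intersects-sym : ∀ {k} {B C : Box k} → Intersects B C → Intersects C B
intersects-sym (p , p∈B , p∈C) = p , p∈C , p∈B

-- At a non-head position in x but not in y, the interval of x ends at `value x` + 1 and that of y
-- starts at 1 + `value y`. Closed intervals that touch still meet, so the strict inequality of
-- values matters.
separated : ∀ {n} (x y : Vec Bool (ℕ.suc n)) → value x ℚ.< value y → ¬ (x ≤ᵛ y) →
            ¬ Intersects (cubes x) (cubes y)
separated x y x<y x≰y (p , p∈x , p∈y) with witness-≰ x y x≰y
-- A witness at the head would give the first vector the larger value.
separated (true ∷ x) (false ∷ y) x<y _ _ | zero , refl , refl =
  ℚ.<-asym x<y (value-head-< y x)
separated x y x<y _ (p , p∈x , p∈y) | suc i , xi≡t , yi≡f =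
  ℚ.<-irrefl refl (begin-strict
    1ℚ ℚ.+ value y                         ≡⟨ cong (λ b → offset b ℚ.+ value y) yi≡f ⟨
    offset (lookup y (suc i)) ℚ.+ value y  ≤⟨ units-meet⁻ (p i) (p∈x i) (p∈y i) ⟩
    offset (lookup x (suc i)) ℚ.+ value x ℚ.+ 1ℚ
                                           ≡⟨ cong (λ b → offset b ℚ.+ value x ℚ.+ 1ℚ) xi≡t ⟩
    0ℚ ℚ.+ value x ℚ.+ 1ℚ                  ≡⟨ cong (ℚ._+ 1ℚ) (ℚ.+-identityˡ (value x)) ⟩
    value x ℚ.+ 1ℚ                         ≡⟨ ℚ.+-comm (value x) 1ℚ ⟩
    1ℚ ℚ.+ value x                         <⟨ ℚ.+-monoʳ-< 1ℚ x<y ⟩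
    1ℚ ℚ.+ value y                         ∎)
  where open ℚ.≤-Reasoning

cubes-represent : ∀ n → Represents (TC-H (ℕ.suc n)) cubes
cubes-represent n x y x≢y = mk⇔ to from
  where
  to : Graph.Adj (TC-H (ℕ.suc n)) x y → Intersects (cubes x) (cubes y)
  to (_ , inj₁ x≤y) = ≤ᵛ⇒cubes-meet x y x≤y
  to (_ , inj₂ y≤x) = intersects-sym {B = cubes y} {cubes x} (≤ᵛ⇒cubes-meet y x y≤x)
  from : Intersects (cubes x) (cubes y) → Graph.Adj (TC-H (ℕ.suc n)) x y
  from meet with x ≤ᵛ? y | y ≤ᵛ? x | value-connex x≢y
  ... | yes x≤y | _       | _        = x≢y , inj₁ x≤y
  ... | no _    | yes y≤x | _        = x≢y , inj₂ y≤x
  -- For incomparable vertices, the one of smaller value goes first.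
  ... | no x≰y  | no _    | inj₁ x<y = contradiction meet (separated x y x<y x≰y)
  ... | no _    | no y≰x  | inj₂ y<x =
    contradiction (intersects-sym {B = cubes x} {cubes y} meet) (separated y x y<x y≰x)

TC-H-cubeRep : ∀ n → HasCubeRep (TC-H (ℕ.suc n)) n
TC-H-cubeRep n = cubes , (λ _ _ → (λ _ l → l) , (λ _ l → l)) , cubes-represent n

cubeRep⇒boxRep : ∀ {Γ k} → HasCubeRep Γ k → HasBoxRep Γ k
cubeRep⇒boxRep (f , _ , rep) = f , rep

corollary1 : ∀ (d : ℕ) → 1 ≤ d →
    ∀ (box cub : ℕ) → IsBoxicity (TC-H d) box → IsCubicity (TC-H d) cub →
    box ≤ cub × cub ≤ d ∸ 1
-- Both bounds come from minimality: of `box` against the cube representation of dimension `cub`,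
-- and of `cub` against the one of dimension `n`.
corollary1 (ℕ.suc n) _ _ cub (_ , box≤) (cubeRep-cub , cub≤) =
  box≤ cub (cubeRep⇒boxRep {TC-H (ℕ.suc n)} cubeRep-cub) , cub≤ n (TC-H-cubeRep n)
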